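{- Let $G$ be a graph with $n$ vertices and vertex degree sequence $d_1(G)\geq d_2(G)\geq \cdots \geq d_n(G)$, let $\mathcal{D}(G)$ be its double graph, and let $0\leq \alpha \leq 1$. Then $$S_{k}(A_{\alpha}(\mathcal{D}(G)))\leq \begin{cases} 4\sum_{i=1}^{k/2}d_i(G)+2(1-\alpha)S_k(A(G)), & \text{if } 1 < k< n \text{ is even};\\ 4\sum_{i=1}^{(k-1)/2}d_i(G)+2d_{(k+1)/2}(G)+2(1-\alpha)S_k(A(G)), & \text{if } 1 \leq k< n \text{ is odd};\\ 4\sum_{i=1}^{k/2}d_i(G), & \text{if } n \leq k\leq 2n \text{ is even};\\ 4\sum_{i=1}^{(k-1)/2}d_i(G)+2d_{(k+1)/2}(G), & \text{if } n \leq k\leq 2n \text{ is odd}. \end{cases}$$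
   Context: All graphs are simple and undirected. $A(G)$ is the adjacency matrix, $D(G)$ the diagonal degree matrix, and $A_{\alpha}(G)=\alpha D(G)+(1-\alpha)A(G)$. For a real symmetric matrix $M$ with eigenvalues $\lambda_1(M)\geq\cdots\geq\lambda_N(M)$, $S_k(M)=\sum_{i=1}^k\lambda_i(M)$. The double graph $\mathcal{D}(G)$ is obtained by taking two copies of $G$ and joining each vertex in one copy with the neighbors of the corresponding vertex in the other copy (so $A(\mathcal{D}(G))=\begin{pmatrix}1&1\\1&1\end{pmatrix}\otimes A(G)$). -}

module Defs where

open import Level using (Level; _⊔_; 0ℓ) renaming (suc to lsuc)
open import Algebra.Apartness.Bundles using (HeytingCommutativeRing; HeytingField)
open import Algebra.Bundles using (CommutativeRing)
import Algebra.Definitions.RawMonoid as RawMonoidDefinitions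
open import Data.Bool.Base using (if_then_else_)
open import Data.Fin.Base as Fin using (Fin; zero; suc; remainder)
open import Data.Fin.Permutation using (Permutation′; _⟨$⟩ʳ_)
open import Data.Fin.Properties using (_≟_)
open import Data.Nat.Base as ℕ using (ℕ; zero; suc)
open import Data.Product.Base using (Σ; ∃; _×_)
open import Data.Sum.Base using (_⊎_)
import Data.Vec.Base as Vec
open import Function.Base using (_∘_)
open import Relation.Binary.Core using (Rel)
open import Relation.Binary.Definitions using (Symmetric; Irreflexive; Decidable)
open import Relation.Binary.PropositionalEquality.Core using (_≡_)
open import Relation.Binary.Structures using (IsStrictPartialOrder)
open import Relation.Nullary.Decidable.Core using (does)
open import Relation.Nullary.Negation.Core using (¬_)

record Graph (n : ℕ) : Set₁ where
  infix 4 _~_ _~?_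
  field
    _~_      : Rel (Fin n) 0ℓ
    ~-sym    : Symmetric _~_
    ~-irrefl : Irreflexive _≡_ _~_
    _~?_     : Decidable _~_

  degree : Fin n → ℕ
  degree u = Vec.count (u ~?_) (Vec.allFin n)

-- A vertex u of the double graph is a pair (copy of G, vertex of G), encoded
-- in Fin (2 * n) as by Data.Fin.combine; remainder n u is the vertex of G.
-- Edges inside a copy and edges between the two copies are both given by
-- adjacency in G, so the copy plays no role in the relation.
double : ∀ {n} → Graph n → Graph (2 ℕ.* n)
double {n} G = record
  { _~_      = λ u v → vertex u ~ vertex v
  ; ~-sym    = ~-sym
  ; ~-irrefl = λ { _≡_.refl → ~-irrefl _≡_.refl }
  ; _~?_     = λ u v → vertex u ~? vertex v
  }
  where
  open Graph G
  vertex : Fin (2 ℕ.* n) → Fin n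
  vertex = remainder {2} n

record IsDegreeSequence {n} (G : Graph n) (d : Fin n → ℕ) : Set where
  field
    nonincreasing : ∀ {i j} → i Fin.≤ j → d j ℕ.≤ d i
    rearrangement : Σ (Permutation′ n) λ π → ∀ i → d i ≡ Graph.degree G (π ⟨$⟩ʳ i)

-- The real numbers, as a Cauchy-complete Archimedean ordered field.  The order
-- is not assumed decidable, so that the axioms are those of the constructive
-- reals; with excluded middle they determine ℝ up to isomorphism.
record RealNumbers (c ℓ₁ ℓ₂ : Level) : Set (lsuc (c ⊔ ℓ₁ ⊔ ℓ₂)) where
  field
    heytingField : HeytingField c ℓ₁ ℓ₂

  open HeytingField heytingField public
  open RawMonoidDefinitions
    (CommutativeRing.+-rawMonoid
      (HeytingCommutativeRing.commutativeRing heytingCommutativeRing)) public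
    using (sum) renaming (_×_ to infixr 8 _·_)

  infix 4 _<_ _≤_
  field
    _<_                  : Rel Carrier ℓ₂
    isStrictPartialOrder : IsStrictPartialOrder _≈_ _<_
    <⇒#                  : ∀ {x y} → x < y → x # y
    #⇒<⊎>                : ∀ {x y} → x # y → x < y ⊎ y < x
    +-monoˡ-<            : ∀ z {x y} → x < y → x + z < y + z
    *-positive           : ∀ {x y} → 0# < x → 0# < y → 0# < x * y
    archimedean          : ∀ x → ∃ λ n → x < n · 1#

  _≤_ : Rel Carrier ℓ₂
  x ≤ y = ¬ (y < x)

  IsCauchy : (ℕ → Carrier) → Set (c ⊔ ℓ₂)
  IsCauchy s = ∀ ε → 0# < ε → ∃ λ N → ∀ p q → N ℕ.≤ p → N ℕ.≤ q → s p - s q < ε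

  infix 4 _ConvergesTo_
  _ConvergesTo_ : (ℕ → Carrier) → Carrier → Set (c ⊔ ℓ₂)
  s ConvergesTo x = ∀ ε → 0# < ε →
    ∃ λ N → ∀ p → N ℕ.≤ p → (x - ε < s p) × (s p < x + ε)

  field
    complete : ∀ s → IsCauchy s → ∃ λ x → s ConvergesTo x

  fromℕ : ℕ → Carrier
  fromℕ m = m · 1#

module Spectra {c ℓ₁ ℓ₂} (ℝ : RealNumbers c ℓ₁ ℓ₂) where
  open RealNumbers ℝ hiding (zero)

  Matrix : ℕ → Set c
  Matrix N = Fin N → Fin N → Carrier

  adjacency : ∀ {n} → Graph n → Matrix n
  adjacency G u v = if does (u ~? v) then 1# else 0#
    where open Graph G

  degreeMatrix : ∀ {n} → Graph n → Matrix n
  degreeMatrix G u v = if does (u ≟ v) then fromℕ (Graph.degree G u) else 0#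

  A[_] : Carrier → ∀ {n} → Graph n → Matrix n
  A[ α ] G u v = α * degreeMatrix G u v + (1# - α) * adjacency G u v

  LinearlyIndependent : ∀ {k N} → (Fin k → Fin N → Carrier) → Set (c ⊔ ℓ₁)
  LinearlyIndependent {k} v =
    ∀ (a : Fin k → Carrier) → (∀ x → sum (λ i → a i * v i x) ≈ 0#) → ∀ i → a i ≈ 0#

  -- The eigenvalues λ₁ ≥ ⋯ ≥ λ_N of an N × N matrix, with multiplicity: N
  -- linearly independent eigenvectors are listed, so that each eigenvalue
  -- occurs as often as the dimension of its eigenspace.  For a real symmetric
  -- matrix such a list exists and its eigenvalues are unique.
  record Spectrum {N} (M : Matrix N) : Set (c ⊔ ℓ₁ ⊔ ℓ₂) where
    field
      eigenvalue    : Fin N → Carrier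
      nonincreasing : ∀ {i j} → i Fin.≤ j → eigenvalue j ≤ eigenvalue i
      eigenvector   : Fin N → Fin N → Carrier
      independent   : LinearlyIndependent eigenvector
      isEigenvector : ∀ i x →
        sum (λ y → M x y * eigenvector i y) ≈ eigenvalue i * eigenvector i x

  -- Sum of the first k terms; all terms are summed when k exceeds the length.
  sumFirst : ℕ → ∀ {N} → (Fin N → Carrier) → Carrier
  sumFirst zero    {_}     f = 0#
  sumFirst (suc k) {zero}  f = 0#
  sumFirst (suc k) {suc N} f = f zero + sumFirst k (f ∘ suc)

  S : ℕ → ∀ {N} {M : Matrix N} → Spectrum M → Carrier
  S k σ = sumFirst k (Spectrum.eigenvalue σ)

{-# OPTIONS --safe #-}

-- A_α(H) ≤ D(H) as quadratic forms for every graph H, because D(H) − A(H) is positive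
-- semidefinite.  If P is the orthogonal projection onto the span of k independent eigenvectors
-- of a matrix M, then tr (M P) is the sum of their eigenvalues, so for M = A_α(D(G)) this sum is
-- at most the sum of deg x · P x x over the vertices x of D(G).  The weights P x x lie in [0, 1]
-- and add up to k, so the weighted sum is at most the sum of the k largest degrees of D(G);
-- these are the numbers 2 d_i, each taken twice.  This gives the last two bounds, for all
-- k ≤ 2n.  The first two bounds only add the term 2 (1 − α) S_k(A(G)), which is nonnegative
-- because A(G) has trace 0.
module Submission where

open import Defs
open import Algebra.Apartness.Bundles using (HeytingCommutativeRing)
open import Algebra.Bundles using (CommutativeRing)
import Algebra.Apartness.Properties.HeytingCommutativeRing as HeytingProperties
import Algebra.Properties.CommutativeMonoid.Sum as SumProperties
import Algebra.Properties.Ring as RingProperties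
import Algebra.Properties.Semiring.Mult as MultProperties
import Algebra.Properties.Semiring.Sum as SemiringSumProperties
import Algebra.Solver.Ring.NaturalCoefficients.Default as SemiringSolver
open import Data.Bool.Base using (true; false; if_then_else_)
open import Data.Fin.Base as Fin using (Fin; zero; suc; toℕ; fromℕ<; _↑ˡ_; _↑ʳ_; combine; remainder)
open import Data.Fin.Permutation using (_⟨$⟩ʳ_)
open import Data.Fin.Properties using (_≟_; toℕ-fromℕ<; toℕ<n; remQuot-combine)
open import Data.Nat.Base as ℕ using (ℕ; zero; suc; z≤n; s≤s)
import Data.Nat.Properties as ℕ
open import Data.Product.Base using (_×_; _,_; proj₁; proj₂; ∃)
open import Data.Sum.Base using (inj₁; inj₂; [_,_]′)
import Data.Vec.Base as Vec
open import Data.Vec.Functional using (_++_)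
open import Data.Vec.Functional.Properties using (lookup-++ˡ; lookup-++ʳ)
open import Function.Base using (_∘_; id)
open import Level using (_⊔_)
open import Relation.Binary.Bundles using (Poset)
import Relation.Binary.PropositionalEquality as ≡
open import Relation.Binary.PropositionalEquality.Core using (_≡_)
import Relation.Binary.Reasoning.PartialOrder as PartialOrderReasoning
import Relation.Binary.Reasoning.Setoid as SetoidReasoning
open import Relation.Binary.Structures using (IsStrictPartialOrder)
open import Relation.Nullary.Decidable.Core using (Dec; does; yes; no)
open import Relation.Nullary.Negation.Core using (¬_; contradiction)

module OrderedField {c ℓ₁ ℓ₂} (ℝ : RealNumbers c ℓ₁ ℓ₂) where
  open RealNumbers ℝ hiding (zero; sum)
  open Spectra ℝ

  ℝ-commutativeRing : CommutativeRing c ℓ₁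
  ℝ-commutativeRing = HeytingCommutativeRing.commutativeRing heytingCommutativeRing

  open CommutativeRing ℝ-commutativeRing
    using (ring; semiring; commutativeSemiring; +-commutativeMonoid)
  open HeytingProperties heytingCommutativeRing using (1#0; x-0≈x; x#0y#0→xy#0)
  open RingProperties ring using (x∙y⁻¹≈ε⇒x≈y; +-identityʳ-unique; -‿distribˡ-*; -‿distribʳ-*; -‿involutive)
  open SumProperties +-commutativeMonoid
    using (sum; sum-cong-≋; sum-replicate; sum-replicate-zero; ∑-distrib-+; ∑-comm; sum-permute; sum-syntax)
  open SemiringSumProperties semiring using (*-distribˡ-sum; *-distribʳ-sum)
  open MultProperties semiring using (×-assocˡ)
  open SemiringSolver commutativeSemiring
    using (Polynomial; solve; con; _:+_; _:*_; _:=_)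
  private module < = IsStrictPartialOrder isStrictPartialOrder

  -- Order and arithmetic of the reals without decidable comparison.

  ≤-reflexive : ∀ {x y} → x ≈ y → x ≤ y
  ≤-reflexive x≈y y<x = <.irrefl (sym x≈y) y<x

  <⇒≤ : ∀ {x y} → x < y → x ≤ y
  <⇒≤ = <.asym

  ≤-antisym : ∀ {x y} → x ≤ y → y ≤ x → x ≈ y
  ≤-antisym {x} {y} x≤y y≤x =
    proj₁ (tight x y) λ x#y → [ y≤x , x≤y ]′ (#⇒<⊎> x#y)

  -- As `≤` is only the negation of `<`, cotransitivity of apartness is used to compare `y` with an
  -- endpoint of the supposed `z < x`.
  ≤-trans : ∀ {x y z} → x ≤ y → y ≤ z → x ≤ z
  ≤-trans {x} {y} {z} x≤y y≤z z<x with #-cotrans (<⇒# z<x) y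
  ... | inj₁ z#y = [ y≤z , (λ y<z → x≤y (<.trans y<z z<x)) ]′ (#⇒<⊎> z#y)
  ... | inj₂ y#x = [ x≤y , (λ x<y → y≤z (<.trans z<x x<y)) ]′ (#⇒<⊎> y#x)

  ≤-poset : Poset c ℓ₁ ℓ₂
  ≤-poset = record
    { _≤_ = _≤_
    ; isPartialOrder = record
      { isPreorder = record
        { isEquivalence = isEquivalence
        ; reflexive     = ≤-reflexive
        ; trans         = ≤-trans
        }
      ; antisym = ≤-antisym
      }
    }

  module ≤-Reasoning = PartialOrderReasoning ≤-poset
  module ≈-Reasoning = SetoidReasoning setoid

  ≤-refl : ∀ {x} → x ≤ x
  ≤-refl = ≤-reflexive refl

  x+[y-x]≈y : ∀ x y → x + (y - x) ≈ y
  x+[y-x]≈y x y = begin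
    x + (y - x)    ≈⟨ +-comm x (y - x) ⟩
    (y - x) + x    ≈⟨ +-assoc y (- x) x ⟩
    y + (- x + x)  ≈⟨ +-congˡ (-‿inverseˡ x) ⟩
    y + 0#         ≈⟨ +-identityʳ y ⟩
    y              ∎
    where open ≈-Reasoning

  +-cancelʳ-< : ∀ z {x y} → x + z < y + z → x < y
  +-cancelʳ-< z lt = <.<-respʳ-≈ (cancel _) (<.<-respˡ-≈ (cancel _) (+-monoˡ-< (- z) lt))
    where
    cancel : ∀ x → x + z - z ≈ x
    cancel x = trans (+-assoc x z (- z)) (trans (+-congˡ (-‿inverseʳ z)) (+-identityʳ x))

  +-monoˡ-≤ : ∀ z {x y} → x ≤ y → x + z ≤ y + z
  +-monoˡ-≤ z x≤y lt = x≤y (+-cancelʳ-< z lt)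

  +-mono-≤ : ∀ {x y u v} → x ≤ y → u ≤ v → x + u ≤ y + v
  +-mono-≤ {x} {y} {u} {v} x≤y u≤v = begin
    x + u  ≤⟨ +-monoˡ-≤ u x≤y ⟩
    y + u  ≈⟨ +-comm y u ⟩
    u + y  ≤⟨ +-monoˡ-≤ y u≤v ⟩
    v + y  ≈⟨ +-comm v y ⟩
    y + v  ∎
    where open ≤-Reasoning

  +-cancelʳ-≤ : ∀ z {x y} → x + z ≤ y + z → x ≤ y
  +-cancelʳ-≤ z le lt = le (+-monoˡ-< z lt)

  x≤y⇒0≤y-x : ∀ {x y} → x ≤ y → 0# ≤ y - x
  x≤y⇒0≤y-x {x} {y} x≤y = +-cancelʳ-≤ x (begin
    0# + x       ≈⟨ +-identityˡ x ⟩
    x            ≤⟨ x≤y ⟩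
    y            ≈⟨ x+[y-x]≈y x y ⟨
    x + (y - x)  ≈⟨ +-comm x (y - x) ⟩
    (y - x) + x  ∎)
    where open ≤-Reasoning

  x≤x+y : ∀ x {y} → 0# ≤ y → x ≤ x + y
  x≤x+y x {y} 0≤y = begin
    x       ≈⟨ +-identityʳ x ⟨
    x + 0#  ≤⟨ +-mono-≤ ≤-refl 0≤y ⟩
    x + y   ∎
    where open ≤-Reasoning

  x<0⇒0<-x : ∀ {x} → x < 0# → 0# < - x
  x<0⇒0<-x {x} x<0 =
    <.<-respʳ-≈ (+-identityˡ (- x)) (<.<-respˡ-≈ (-‿inverseʳ x) (+-monoˡ-< (- x) x<0))

  0<-x⇒x<0 : ∀ {x} → 0# < - x → x < 0#
  0<-x⇒x<0 {x} 0<-x =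
    <.<-respʳ-≈ (-‿inverseˡ x) (<.<-respˡ-≈ (+-identityˡ x) (+-monoˡ-< x 0<-x))

  -- The goal is a negation, so both factors may be taken positive: a nonnegative factor that is not
  -- positive is 0 by antisymmetry, and then the product vanishes.
  *-nonneg : ∀ {x y} → 0# ≤ x → 0# ≤ y → 0# ≤ x * y
  *-nonneg {x} {y} 0≤x 0≤y xy<0 = ¬0<x λ 0<x → ¬0<y λ 0<y → <⇒≤ (*-positive 0<x 0<y) xy<0
    where
    ¬0<x : ¬ ¬ 0# < x
    ¬0<x x≤0 = <.irrefl (trans (*-congʳ (≤-antisym x≤0 0≤x)) (zeroˡ y)) xy<0
    ¬0<y : ¬ ¬ 0# < y
    ¬0<y y≤0 = <.irrefl (trans (*-congˡ (≤-antisym y≤0 0≤y)) (zeroʳ x)) xy<0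

  square-nonneg : ∀ x → 0# ≤ x * x
  square-nonneg x xx<0 = *-nonneg 0≤x 0≤x xx<0
    where
    -- A negative `x` is excluded because its square is also the square of the nonnegative `- x`.
    0≤x : 0# ≤ x
    0≤x x<0 = *-nonneg (<⇒≤ 0<-x) (<⇒≤ 0<-x) (<.<-respˡ-≈ eq xx<0)
      where
      0<-x = x<0⇒0<-x x<0
      eq : x * x ≈ - x * - x
      eq = trans (sym (-‿involutive (x * x)))
             (trans (-‿cong (-‿distribˡ-* x x)) (-‿distribʳ-* (- x) x))

  *-monoˡ-≤ : ∀ {x y z} → 0# ≤ z → x ≤ y → z * x ≤ z * y
  *-monoˡ-≤ {x} {y} {z} 0≤z x≤y = begin
    z * x                ≤⟨ x≤x+y (z * x) (*-nonneg 0≤z (x≤y⇒0≤y-x x≤y)) ⟩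
    z * x + z * (y - x)  ≈⟨ distribˡ z x (y - x) ⟨
    z * (x + (y - x))    ≈⟨ *-congˡ (x+[y-x]≈y x y) ⟩
    z * y                ∎
    where open ≤-Reasoning

  0≤1 : 0# ≤ 1#
  0≤1 = ≤-trans (square-nonneg 1#) (≤-reflexive (*-identityˡ 1#))

  0<1 : 0# < 1#
  0<1 = [ (λ 1<0 → contradiction 1<0 0≤1) , id ]′ (#⇒<⊎> 1#0)

  fromℕ-nonneg : ∀ m → 0# ≤ fromℕ m
  fromℕ-nonneg zero    = ≤-refl
  fromℕ-nonneg (suc m) = ≤-trans 0≤1 (x≤x+y 1# (fromℕ-nonneg m))

  -- Cotransitivity applied to `1# # 0#` makes the number apart from 1 or from 0; the weak
  -- inequalities already known then fix the direction.
  0<fromℕ-suc : ∀ m → 0# < fromℕ (suc m)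
  0<fromℕ-suc m with #-cotrans 1#0 (fromℕ (suc m))
  ... | inj₂ m#0 = [ (λ m<0 → contradiction m<0 (fromℕ-nonneg (suc m))) , id ]′ (#⇒<⊎> m#0)
  ... | inj₁ 1#m =
    [ <.trans 0<1 , (λ m<1 → contradiction m<1 (x≤x+y 1# (fromℕ-nonneg m))) ]′ (#⇒<⊎> 1#m)

  fromℕ-mono : ∀ {m n} → m ℕ.≤ n → fromℕ m ≤ fromℕ n
  fromℕ-mono {n = n} z≤n       = fromℕ-nonneg n
  fromℕ-mono         (s≤s m≤n) = +-mono-≤ ≤-refl (fromℕ-mono m≤n)

  *-cancelˡ-nonneg : ∀ {x y} → 0# < x → 0# ≤ x * y → 0# ≤ y
  *-cancelˡ-nonneg {x} {y} 0<x 0≤xy y<0 =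
    0≤xy (0<-x⇒x<0 (<.<-respʳ-≈ (sym (-‿distribʳ-* x y)) (*-positive 0<x (x<0⇒0<-x y<0))))

  square≈0⇒≈0 : ∀ {x} → x * x ≈ 0# → x ≈ 0#
  square≈0⇒≈0 {x} xx≈0 = proj₁ (tight x 0#) λ x#0 → #-irrefl xx≈0 (x#0y#0→xy#0 x#0 x#0)

  -- If `1# < x`, then `x * (x - 1#)` is positive, so the square exceeds `x`. This caps the diagonal
  -- entries of a projection.
  square≤self⇒≤1 : ∀ {x} → x * x ≤ x → x ≤ 1#
  square≤self⇒≤1 {x} xx≤x 1<x = xx≤x (<.<-respˡ-≈ (+-identityˡ x) (<.<-respʳ-≈ eq
      (+-monoˡ-< x (*-positive (<.trans 0<1 1<x) 0<x-1))))
    where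
    0<x-1 : 0# < x - 1#
    0<x-1 = <.<-respˡ-≈ (-‿inverseʳ 1#) (+-monoˡ-< (- 1#) 1<x)
    eq : x * (x - 1#) + x ≈ x * x
    eq = begin
      x * (x - 1#) + x       ≈⟨ +-congˡ (*-identityʳ x) ⟨
      x * (x - 1#) + x * 1#  ≈⟨ distribˡ x (x - 1#) 1# ⟨
      x * ((x - 1#) + 1#)    ≈⟨ *-congˡ (trans (+-comm _ _) (x+[y-x]≈y 1# x)) ⟩
      x * x                  ∎
      where open ≈-Reasoning

  -- The two sides differ by `(b - a) * (t - s)`. Writing `b = a + e` and `t = s + f` removes
  -- subtraction, which the semiring solver cannot handle.
  rearrangement-≤ : ∀ {a b s t} → a ≤ b → s ≤ t → b * s + a * t ≤ a * s + b * t
  rearrangement-≤ {a} {b} {s} {t} a≤b s≤t = begin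
    b * s + a * t                ≈⟨ +-cong (*-congʳ b≈) (*-congˡ t≈) ⟩
    (a + e) * s + a * (s + f)    ≤⟨ x≤x+y _ (*-nonneg (x≤y⇒0≤y-x a≤b) (x≤y⇒0≤y-x s≤t)) ⟩
    (a + e) * s + a * (s + f) + e * f
      ≈⟨ solve 4 (λ a s e f → (a :+ e) :* s :+ a :* (s :+ f) :+ e :* f
                   := a :* s :+ (a :+ e) :* (s :+ f)) refl a s e f ⟩
    a * s + (a + e) * (s + f)    ≈⟨ +-congˡ (*-cong b≈ t≈) ⟨
    a * s + b * t                ∎
    where
    open ≤-Reasoning
    e = b - a
    f = t - s
    b≈ : b ≈ a + e
    b≈ = sym (x+[y-x]≈y a b)
    t≈ : t ≈ s + f
    t≈ = sym (x+[y-x]≈y s t)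

  x+x≤y+y⇒x≤y : ∀ {x y} → x + x ≤ y + y → x ≤ y
  x+x≤y+y⇒x≤y {x} {y} le y<x = le (<.trans (+-monoˡ-< y y<x)
    (<.<-respˡ-≈ (+-comm y x) (+-monoˡ-< x y<x)))

  2xy≤x²+y² : ∀ x y → y * x + y * x ≤ x * x + y * y
  2xy≤x²+y² x y = begin
    y * x + y * x                  ≈⟨ +-cong (*-congʳ y≈) (*-congʳ y≈) ⟩
    (x + e) * x + (x + e) * x      ≤⟨ x≤x+y _ (square-nonneg e) ⟩
    (x + e) * x + (x + e) * x + e * e
      ≈⟨ solve 2 (λ x e → (x :+ e) :* x :+ (x :+ e) :* x :+ e :* e := x :* x :+ (x :+ e) :* (x :+ e)) refl x e ⟩
    x * x + (x + e) * (x + e)      ≈⟨ +-congˡ (*-cong y≈ y≈) ⟨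
    x * x + y * y                  ∎
    where
    open ≤-Reasoning
    e = y - x
    y≈ : y ≈ x + e
    y≈ = sym (x+[y-x]≈y x y)

  0<fromℕ : ∀ {k n} → k ℕ.< n → 0# < fromℕ n
  0<fromℕ {n = suc n} _ = 0<fromℕ-suc n

  ·-nonneg : ∀ m {x} → 0# ≤ x → 0# ≤ m · x
  ·-nonneg zero    0≤x = ≤-refl
  ·-nonneg (suc m) 0≤x = ≤-trans 0≤x (x≤x+y _ (·-nonneg m 0≤x))

  -- Inequalities between finite sums.

  sum-mono-≤ : ∀ {n} {f g : Fin n → Carrier} → (∀ i → f i ≤ g i) → sum f ≤ sum g
  sum-mono-≤ {zero}  f≤g = ≤-refl
  sum-mono-≤ {suc n} f≤g = +-mono-≤ (f≤g zero) (sum-mono-≤ (f≤g ∘ suc))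

  sum-nonneg : ∀ {n} {f : Fin n → Carrier} → (∀ i → 0# ≤ f i) → 0# ≤ sum f
  sum-nonneg {n} 0≤f = ≤-trans (≤-reflexive (sym (sum-replicate-zero n))) (sum-mono-≤ 0≤f)

  term≤sum : ∀ {n} {f : Fin n → Carrier} → (∀ i → 0# ≤ f i) → ∀ i → f i ≤ sum f
  term≤sum 0≤f zero    = x≤x+y _ (sum-nonneg (0≤f ∘ suc))
  term≤sum {f = f} 0≤f (suc i) = begin
    f (suc i)             ≤⟨ term≤sum (0≤f ∘ suc) i ⟩
    sum (f ∘ suc)         ≤⟨ x≤x+y _ (0≤f zero) ⟩
    sum (f ∘ suc) + f zero  ≈⟨ +-comm _ _ ⟩
    sum f                 ∎
    where open ≤-Reasoning

  sum≈0⇒term≈0 : ∀ {n} {f : Fin n → Carrier} → (∀ i → 0# ≤ f i) → sum f ≈ 0# → ∀ i → f i ≈ 0#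
  sum≈0⇒term≈0 0≤f ∑≈0 i = ≤-antisym (≤-trans (term≤sum 0≤f i) (≤-reflexive ∑≈0)) (0≤f i)

  sum-zero : ∀ {n} {f : Fin n → Carrier} → (∀ i → f i ≈ 0#) → sum f ≈ 0#
  sum-zero {n} f≈0 = trans (sum-cong-≋ f≈0) (sum-replicate-zero n)

  sum-const : ∀ n x → sum {n} (λ _ → x) ≈ n · x
  sum-const n x = sum-replicate n

  sum-↑ : ∀ m {n} (f : Fin (m ℕ.+ n) → Carrier) →
    sum f ≈ sum (λ i → f (i ↑ˡ n)) + sum (λ i → f (m ↑ʳ i))
  sum-↑ zero    f = sym (+-identityˡ _)
  sum-↑ (suc m) f = trans (+-congˡ (sum-↑ m (f ∘ suc))) (sym (+-assoc _ _ _))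

  sumFirst-↑ : ∀ k {r} (f : Fin (k ℕ.+ r) → Carrier) → sumFirst k f ≈ sum (λ i → f (i ↑ˡ r))
  sumFirst-↑ zero    f = refl
  sumFirst-↑ (suc k) f = +-congˡ (sumFirst-↑ k (f ∘ suc))

  -- For fixed ∑ t the left-hand side is largest when t is b on the m largest values of f,
  -- which a threshold θ separates from the others; the terms in θ allow any ∑ t.
  weighted-sum-≤ : ∀ {n} m (f t : Fin n → Carrier) b θ → m ℕ.≤ n →
    (∀ i → toℕ i ℕ.< m → θ ≤ f i) → (∀ i → m ℕ.≤ toℕ i → f i ≤ θ) →
    (∀ i → 0# ≤ t i) → (∀ i → t i ≤ b) →
    ∑[ i < n ] (f i * t i) + θ * (m · b) ≤ b * sumFirst m f + θ * sum t
  weighted-sum-≤ {zero} zero f t b θ _ _ _ _ _ =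
    ≤-reflexive (+-congʳ (sym (zeroʳ b)))
  weighted-sum-≤ {suc n} zero f t b θ _ _ f≤θ 0≤t t≤b = begin
    f₀ * t₀ + R + θ * 0#
      ≈⟨ solve 4 (λ f₀ t₀ θ R → f₀ :* t₀ :+ R :+ θ :* con 0 := (R :+ θ :* con 0) :+ t₀ :* f₀) refl f₀ t₀ θ R ⟩
    (R + θ * 0#) + t₀ * f₀
      ≤⟨ +-mono-≤ (weighted-sum-≤ zero (f ∘ suc) (t ∘ suc) b θ z≤n (λ _ ()) (λ i _ → f≤θ (suc i) z≤n) (0≤t ∘ suc) (t≤b ∘ suc))
                  (*-monoˡ-≤ (0≤t zero) (f≤θ zero z≤n)) ⟩
    (b * 0# + θ * T) + t₀ * θ
      ≈⟨ solve 4 (λ b t₀ θ T → (b :* con 0 :+ θ :* T) :+ t₀ :* θ := b :* con 0 :+ θ :* (t₀ :+ T)) refl b t₀ θ T ⟩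
    b * 0# + θ * (t₀ + T) ∎
    where
    open ≤-Reasoning
    f₀ = f zero
    t₀ = t zero
    T = sum (t ∘ suc)
    R = ∑[ i < n ] (f (suc i) * t (suc i))
  weighted-sum-≤ {suc n} (suc m) f t b θ (s≤s m≤n) θ≤f f≤θ 0≤t t≤b = begin
    f₀ * t₀ + R + θ * (b + K)
      ≈⟨ solve 6 (λ f₀ t₀ θ R b K → f₀ :* t₀ :+ R :+ θ :* (b :+ K)
                   := (f₀ :* t₀ :+ θ :* b) :+ (R :+ θ :* K)) refl f₀ t₀ θ R b K ⟩
    (f₀ * t₀ + θ * b) + (R + θ * K)
      ≤⟨ +-mono-≤ (rearrangement-≤ (θ≤f zero (s≤s z≤n)) (t≤b zero))
           (weighted-sum-≤ m (f ∘ suc) (t ∘ suc) b θ m≤n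
             (λ i i<m → θ≤f (suc i) (s≤s i<m)) (λ i m≤i → f≤θ (suc i) (s≤s m≤i)) (0≤t ∘ suc) (t≤b ∘ suc)) ⟩
    (θ * t₀ + f₀ * b) + (b * F + θ * T)
      ≈⟨ solve 6 (λ f₀ t₀ θ T b F → (θ :* t₀ :+ f₀ :* b) :+ (b :* F :+ θ :* T)
                   := b :* (f₀ :+ F) :+ θ :* (t₀ :+ T)) refl f₀ t₀ θ T b F ⟩
    b * (f₀ + F) + θ * (t₀ + T) ∎
    where
    open ≤-Reasoning
    f₀ = f zero
    t₀ = t zero
    T = sum (t ∘ suc)
    R = ∑[ i < n ] (f (suc i) * t (suc i))
    F = sumFirst m (f ∘ suc)
    K = m · b

  -- The Kronecker delta and exchange of summations.

  δ : ∀ {n} → Fin n → Fin n → Carrier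
  δ i j = if does (i ≟ j) then 1# else 0#

  sum-diagonal : ∀ {n} (i : Fin n) a (f : Fin n → Carrier) →
    ∑[ j < n ] ((if does (i ≟ j) then a else 0#) * f j) ≈ a * f i
  sum-diagonal zero    a f =
    trans (+-congˡ (sum-zero (λ j → zeroˡ (f (suc j))))) (+-identityʳ _)
  sum-diagonal (suc i) a f =
    trans (+-cong (zeroˡ _) (sum-diagonal i a (f ∘ suc))) (+-identityˡ _)

  sum-δ : ∀ {n} (i : Fin n) (f : Fin n → Carrier) → ∑[ j < n ] (δ i j * f j) ≈ f i
  sum-δ i f = trans (sum-diagonal i 1# f) (*-identityˡ (f i))

  δ-refl : ∀ {n} (i : Fin n) → δ i i ≡ 1#
  δ-refl zero    = ≡.refl
  δ-refl (suc i) = δ-refl i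

  *-sum-sum-* : ∀ {k N} (m : Fin N → Carrier) (a : Fin k → Fin N → Carrier) (b : Fin k → Carrier) →
    ∑[ z < N ] (m z * ∑[ i < k ] (a i z * b i)) ≈ ∑[ i < k ] (∑[ z < N ] (m z * a i z) * b i)
  *-sum-sum-* {k} {N} m a b = begin
    ∑[ z < N ] (m z * ∑[ i < k ] (a i z * b i))
      ≈⟨ sum-cong-≋ (λ z → *-distribˡ-sum (m z) (λ i → a i z * b i)) ⟩
    ∑[ z < N ] ∑[ i < k ] (m z * (a i z * b i))
      ≈⟨ ∑-comm (λ z i → m z * (a i z * b i)) ⟩
    ∑[ i < k ] ∑[ z < N ] (m z * (a i z * b i))
      ≈⟨ sum-cong-≋ (λ i → sum-cong-≋ λ z → sym (*-assoc (m z) (a i z) (b i))) ⟩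
    ∑[ i < k ] ∑[ z < N ] (m z * a i z * b i)
      ≈⟨ sum-cong-≋ (λ i → sym (*-distribʳ-sum (b i) (λ z → m z * a i z))) ⟩
    ∑[ i < k ] (∑[ z < N ] (m z * a i z) * b i) ∎
    where open ≈-Reasoning

  sum-*-sum-* : ∀ {k N} (a : Fin k → Carrier) (b : Fin k → Fin N → Carrier) (m : Fin N → Carrier) →
    ∑[ z < N ] (∑[ i < k ] (a i * b i z) * m z) ≈ ∑[ i < k ] (a i * ∑[ z < N ] (b i z * m z))
  sum-*-sum-* {k} {N} a b m = begin
    ∑[ z < N ] (∑[ i < k ] (a i * b i z) * m z)
      ≈⟨ sum-cong-≋ (λ z → trans (*-comm _ (m z)) (*-congˡ (sum-cong-≋ λ i → *-comm (a i) (b i z)))) ⟩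
    ∑[ z < N ] (m z * ∑[ i < k ] (b i z * a i))
      ≈⟨ *-sum-sum-* m b a ⟩
    ∑[ i < k ] (∑[ z < N ] (m z * b i z) * a i)
      ≈⟨ sum-cong-≋ (λ i → trans (*-comm _ (a i)) (*-congˡ (sum-cong-≋ λ z → *-comm (m z) (b i z)))) ⟩
    ∑[ i < k ] (a i * ∑[ z < N ] (b i z * m z)) ∎
    where open ≈-Reasoning

  -- Inner products, dual bases and orthogonal projections.

  infix 8 _∙_
  _∙_ : ∀ {N} → (Fin N → Carrier) → (Fin N → Carrier) → Carrier
  u ∙ v = sum (λ x → u x * v x)

  ∙-comm : ∀ {N} (u v : Fin N → Carrier) → u ∙ v ≈ v ∙ u
  ∙-comm u v = sum-cong-≋ λ x → *-comm (u x) (v x)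

  ∙-distribˡ : ∀ {N} (u v w : Fin N → Carrier) → u ∙ (λ x → v x + w x) ≈ u ∙ v + u ∙ w
  ∙-distribˡ u v w = trans (sum-cong-≋ λ x → distribˡ (u x) (v x) (w x)) (∑-distrib-+ (λ x → u x * v x) (λ x → u x * w x))

  ∙-distribʳ : ∀ {N} (u v w : Fin N → Carrier) → (λ x → v x + w x) ∙ u ≈ v ∙ u + w ∙ u
  ∙-distribʳ u v w = trans (sum-cong-≋ λ x → distribʳ (u x) (v x) (w x)) (∑-distrib-+ (λ x → v x * u x) (λ x → w x * u x))

  *-∙ : ∀ {N} s (u v : Fin N → Carrier) → (λ x → s * u x) ∙ v ≈ s * u ∙ v
  *-∙ s u v = trans (sum-cong-≋ λ x → *-assoc s (u x) (v x)) (sym (*-distribˡ-sum s (λ x → u x * v x)))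

  -- The symmetry says that the dual vectors span the same space as v, so that
  -- projection is the orthogonal projection onto it.
  record DualBasis {k N} (v : Fin k → Fin N → Carrier) : Set (c ⊔ ℓ₁) where
    field
      dual : Fin k → Fin N → Carrier

    projection : Matrix N
    projection x y = ∑[ i < k ] (v i x * dual i y)

    field
      dual∙v               : ∀ i j → dual i ∙ v j ≈ δ i j
      projection-symmetric : ∀ x y → projection x y ≈ projection y x

    projection-apply : ∀ u x → projection x ∙ u ≈ ∑[ i < k ] (v i x * dual i ∙ u)
    projection-apply u x = sum-*-sum-* (λ i → v i x) dual u

    projection-fixes-v : ∀ j x → projection x ∙ v j ≈ v j x
    projection-fixes-v j x = begin
      projection x ∙ v j                  ≈⟨ projection-apply (v j) x ⟩
      ∑[ i < k ] (v i x * dual i ∙ v j)   ≈⟨ sum-cong-≋ (λ i → trans (*-congˡ (dual∙v i j)) (trans (*-comm _ _) (*-congʳ (δ-sym i j)))) ⟩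
      ∑[ i < k ] (δ j i * v i x)          ≈⟨ sum-δ j (λ i → v i x) ⟩
      v j x                               ∎
      where
      open ≈-Reasoning
      δ-sym : ∀ {n} (i j : Fin n) → δ i j ≈ δ j i
      δ-sym zero    zero    = refl
      δ-sym zero    (suc j) = refl
      δ-sym (suc i) zero    = refl
      δ-sym (suc i) (suc j) = δ-sym i j

    matrix*projection : ∀ (M : Matrix N) x y →
      ∑[ z < N ] (M x z * projection z y) ≈ ∑[ i < k ] (M x ∙ v i * dual i y)
    matrix*projection M x y = *-sum-sum-* (M x) v (λ i → dual i y)

    -- Every column of the projection is a combination of the vectors `v i`, and these are fixed.
    projection-idempotent : ∀ x y → ∑[ z < N ] (projection x z * projection z y) ≈ projection x y
    projection-idempotent x y =
      trans (matrix*projection projection x y) (sum-cong-≋ λ i → *-congʳ (projection-fixes-v i x))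

    -- By symmetry, idempotence makes a diagonal entry the squared length of its row. Both bounds on
    -- the diagonal come from this.
    projection-diagonal : ∀ x → projection x ∙ projection x ≈ projection x x
    projection-diagonal x =
      trans (sum-cong-≋ λ z → *-congˡ (projection-symmetric x z)) (projection-idempotent x x)

    projection-diagonal-nonneg : ∀ x → 0# ≤ projection x x
    projection-diagonal-nonneg x =
      ≤-trans (sum-nonneg λ z → square-nonneg (projection x z)) (≤-reflexive (projection-diagonal x))

    projection-diagonal-≤1 : ∀ x → projection x x ≤ 1#
    projection-diagonal-≤1 x = square≤self⇒≤1 (≤-trans
      -- The square of the diagonal entry is itself one of the squares in its row.
      (term≤sum (λ z → square-nonneg (projection x z)) x) (≤-reflexive (projection-diagonal x)))

    -- The matrix is a sum of rank-one terms, and the trace of the term for `i` is `μ i` times the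
    -- inner product of `v i` with its own dual vector, which is 1.
    weighted-trace : ∀ (μ : Fin k → Carrier) →
      ∑[ x < N ] ∑[ i < k ] (μ i * v i x * dual i x) ≈ sum μ
    weighted-trace μ = begin
      ∑[ x < N ] ∑[ i < k ] (μ i * v i x * dual i x)
        ≈⟨ ∑-comm (λ x i → μ i * v i x * dual i x) ⟩
      ∑[ i < k ] ∑[ x < N ] (μ i * v i x * dual i x)
        ≈⟨ sum-cong-≋ (λ i → *-∙ (μ i) (v i) (dual i)) ⟩
      ∑[ i < k ] (μ i * v i ∙ dual i)
        ≈⟨ sum-cong-≋ (λ i → trans (*-congˡ (trans (∙-comm (v i) (dual i)) (trans (dual∙v i i) (reflexive (δ-refl i))))) (*-identityʳ _)) ⟩
      sum μ ∎
      where open ≈-Reasoning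

    projection-trace : ∑[ x < N ] projection x x ≈ fromℕ k
    projection-trace = begin
      ∑[ x < N ] projection x x                          ≈⟨ sum-cong-≋ (λ x → sum-cong-≋ λ i → *-congʳ (sym (*-identityˡ (v i x)))) ⟩
      ∑[ x < N ] ∑[ i < k ] (1# * v i x * dual i x)      ≈⟨ weighted-trace (λ _ → 1#) ⟩
      ∑[ i < k ] 1#                                      ≈⟨ sum-const k 1# ⟩
      fromℕ k                                            ∎
      where open ≈-Reasoning

    eigenvalue-trace : ∀ (M : Matrix N) (μ : Fin k → Carrier) →
      (∀ i x → M x ∙ v i ≈ μ i * v i x) →
      ∑[ x < N ] ∑[ z < N ] (M x z * projection z x) ≈ sum μ
    eigenvalue-trace M μ eigen = trans
      (sum-cong-≋ λ x → trans (matrix*projection M x x) (sum-cong-≋ λ i → *-congʳ (eigen i x)))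
      (weighted-trace μ)

  -- One Gram-Schmidt step: adding a vector to a family with a dual basis.

  module DualBasisStep {k N} (v : Fin (suc k) → Fin N → Carrier)
    (independent : LinearlyIndependent v) (D : DualBasis (v ∘ suc)) where

    open DualBasis D

    v₀ : Fin N → Carrier
    v₀ = v zero

    -v₀ : Fin N → Carrier
    -v₀ x = - v₀ x

    coefficient : Fin k → Carrier
    coefficient i = dual i ∙ -v₀

    -- minus the projection of v₀ to the span of the other vectors
    correction : Fin N → Carrier
    correction x = ∑[ i < k ] (v (suc i) x * coefficient i)

    -- The component of `v₀` orthogonal to the span of the other vectors.
    u : Fin N → Carrier
    u x = v₀ x + correction x

    [v₀-v₀]∙ : ∀ w → v₀ ∙ w + -v₀ ∙ w ≈ 0#
    [v₀-v₀]∙ w = trans (sym (∙-distribʳ w v₀ -v₀))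
      (sum-zero λ x → trans (*-congʳ (-‿inverseʳ (v₀ x))) (zeroˡ (w x)))

    -- `correction` is the projection of `-v₀`; symmetry moves the projection to the other factor
    -- `v (suc j)`, which it fixes.
    correction∙v : ∀ j → correction ∙ v (suc j) ≈ -v₀ ∙ v (suc j)
    correction∙v j = begin
      correction ∙ v (suc j)
        ≈⟨ sum-cong-≋ (λ x → *-congʳ (sym (projection-apply -v₀ x))) ⟩
      ∑[ x < N ] (∑[ y < N ] (projection x y * -v₀ y) * v (suc j) x)
        ≈⟨ sum-cong-≋ (λ x → *-congʳ (sum-cong-≋ λ y → trans (*-comm _ _) (*-congˡ (projection-symmetric x y)))) ⟩
      ∑[ x < N ] (∑[ y < N ] (-v₀ y * projection y x) * v (suc j) x)
        ≈⟨ sum-*-sum-* -v₀ projection (v (suc j)) ⟩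
      ∑[ y < N ] (-v₀ y * projection y ∙ v (suc j))
        ≈⟨ sum-cong-≋ (λ y → *-congˡ (projection-fixes-v j y)) ⟩
      -v₀ ∙ v (suc j) ∎
      where open ≈-Reasoning

    u∙v : ∀ j → u ∙ v (suc j) ≈ 0#
    u∙v j = trans (∙-distribʳ (v (suc j)) v₀ correction)
      (trans (+-congˡ (correction∙v j)) ([v₀-v₀]∙ (v (suc j))))

    -- `u` differs from `v₀` by a combination of vectors to which `u` is orthogonal.
    u∙u≈u∙v₀ : u ∙ u ≈ u ∙ v₀
    u∙u≈u∙v₀ = trans (∙-distribˡ u v₀ correction) (trans (+-congˡ u∙correction) (+-identityʳ _))
      where
      u∙correction : u ∙ correction ≈ 0#
      u∙correction = trans (*-sum-sum-* u (v ∘ suc) coefficient)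
        (sum-zero λ i → trans (*-congʳ (u∙v i)) (zeroˡ _))

    -- If the sum of squares were 0, every entry of `u` would be 0, and this would be a linear
    -- relation among the `v i` with coefficient 1 at `v₀`.
    u∙u≉0 : ¬ u ∙ u ≈ 0#
    u∙u≉0 u∙u≈0 = #-irrefl (independent a combination≈0 zero) 1#0
      where
      a : Fin (suc k) → Carrier
      a zero    = 1#
      a (suc i) = coefficient i
      combination≈0 : ∀ x → ∑[ i < suc k ] (a i * v i x) ≈ 0#
      combination≈0 x = trans
        (+-cong (*-identityˡ _) (sum-cong-≋ λ i → *-comm (coefficient i) (v (suc i) x)))
        (square≈0⇒≈0 (sum≈0⇒term≈0 (λ y → square-nonneg (u y)) u∙u≈0 x))

    extend : u ∙ u # 0# → DualBasis v
    extend u∙u#0 = record { dual = dual⁺ ; dual∙v = dual⁺∙v ; projection-symmetric = symmetric }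
      where
      q : Carrier
      q = proj₁ (#⇒invertible u∙u#0)

      q*u∙u≈1 : q * u ∙ u ≈ 1#
      -- `#⇒invertible` inverts the difference `u ∙ u - 0#`.
      q*u∙u≈1 = trans (*-congˡ (sym (x-0≈x (u ∙ u)))) (proj₁ (proj₂ (#⇒invertible u∙u#0)))

      dual₀ : Fin N → Carrier
      dual₀ y = q * u y

      -- The new dual vector is `u` scaled to have inner product 1 with `v₀`. Each old one receives
      -- the multiple of it that cancels its inner product with `v₀`; those with the other vectors
      -- are unchanged, as `u` is orthogonal to them.
      dual⁺ : Fin (suc k) → Fin N → Carrier
      dual⁺ zero      = dual₀
      dual⁺ (suc i) y = dual i y + coefficient i * dual₀ y

      dual₀∙v₀ : dual₀ ∙ v₀ ≈ 1#
      dual₀∙v₀ = trans (*-∙ q u v₀) (trans (*-congˡ (sym u∙u≈u∙v₀)) q*u∙u≈1)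

      dual₀∙v : ∀ j → dual₀ ∙ v (suc j) ≈ 0#
      dual₀∙v j = trans (*-∙ q u (v (suc j))) (trans (*-congˡ (u∙v j)) (zeroʳ q))

      dual⁺-suc∙ : ∀ i w → dual⁺ (suc i) ∙ w ≈ dual i ∙ w + coefficient i * dual₀ ∙ w
      dual⁺-suc∙ i w = trans (∙-distribʳ w (dual i) (λ y → coefficient i * dual₀ y))
        (+-congˡ (*-∙ (coefficient i) dual₀ w))

      dual⁺∙v : ∀ i j → dual⁺ i ∙ v j ≈ δ i j
      dual⁺∙v zero    zero    = dual₀∙v₀
      dual⁺∙v zero    (suc j) = dual₀∙v j
      dual⁺∙v (suc i) zero    = begin
        dual⁺ (suc i) ∙ v₀                        ≈⟨ dual⁺-suc∙ i v₀ ⟩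
        dual i ∙ v₀ + coefficient i * dual₀ ∙ v₀  ≈⟨ +-congˡ (trans (*-congˡ dual₀∙v₀) (*-identityʳ _)) ⟩
        dual i ∙ v₀ + dual i ∙ -v₀                ≈⟨ +-cong (∙-comm (dual i) v₀) (∙-comm (dual i) -v₀) ⟩
        v₀ ∙ dual i + -v₀ ∙ dual i                ≈⟨ [v₀-v₀]∙ (dual i) ⟩
        0#                                        ∎
        where open ≈-Reasoning
      dual⁺∙v (suc i) (suc j) = begin
        dual⁺ (suc i) ∙ v (suc j)                               ≈⟨ dual⁺-suc∙ i (v (suc j)) ⟩
        dual i ∙ v (suc j) + coefficient i * dual₀ ∙ v (suc j)  ≈⟨ +-cong (dual∙v i j) (trans (*-congˡ (dual₀∙v j)) (zeroʳ _)) ⟩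
        δ i j + 0#                                              ≈⟨ +-identityʳ (δ i j) ⟩
        δ i j                                                   ∎
        where open ≈-Reasoning

      -- The new projection is the old one plus a multiple of the rank-one matrix of `u`. Both
      -- summands are symmetric, hence so is the sum.
      decomposition : ∀ x y → ∑[ i < suc k ] (v i x * dual⁺ i y) ≈ projection x y + u x * (q * u y)
      decomposition x y = begin
        v₀ x * d + ∑[ i < k ] (v (suc i) x * (dual i y + coefficient i * d))
          ≈⟨ +-congˡ (sum-cong-≋ λ i → solve 4 (λ a b e d → a :* (b :+ e :* d) := a :* b :+ a :* e :* d) refl
               (v (suc i) x) (dual i y) (coefficient i) d) ⟩
        v₀ x * d + ∑[ i < k ] (v (suc i) x * dual i y + v (suc i) x * coefficient i * d)
          ≈⟨ +-congˡ (∑-distrib-+ (λ i → v (suc i) x * dual i y) (λ i → v (suc i) x * coefficient i * d)) ⟩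
        v₀ x * d + (projection x y + ∑[ i < k ] (v (suc i) x * coefficient i * d))
          ≈⟨ +-congˡ (+-congˡ (sym (*-distribʳ-sum d (λ i → v (suc i) x * coefficient i)))) ⟩
        v₀ x * d + (projection x y + correction x * d)
          ≈⟨ solve 4 (λ a b e d → a :* d :+ (b :+ e :* d) := b :+ (a :+ e) :* d) refl
               (v₀ x) (projection x y) (correction x) d ⟩
        projection x y + u x * d ∎
        where
        open ≈-Reasoning
        d = dual₀ y

      symmetric : ∀ x y → ∑[ i < suc k ] (v i x * dual⁺ i y) ≈ ∑[ i < suc k ] (v i y * dual⁺ i x)
      symmetric x y = begin
        ∑[ i < suc k ] (v i x * dual⁺ i y)  ≈⟨ decomposition x y ⟩
        projection x y + u x * (q * u y)    ≈⟨ +-cong (projection-symmetric x y)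
          (solve 3 (λ a q b → a :* (q :* b) := b :* (q :* a)) refl (u x) q (u y)) ⟩
        projection y x + u y * (q * u x)    ≈⟨ decomposition y x ⟨
        ∑[ i < suc k ] (v i y * dual⁺ i x)  ∎
        where open ≈-Reasoning

  -- Doubly negated because the pivots u ∙ u are only known not to equal 0, whereas an
  -- inverse needs apartness.
  dualBasis : ∀ {k N} (v : Fin k → Fin N → Carrier) → LinearlyIndependent v → ¬ ¬ DualBasis v
  dualBasis {zero}  v independent none =
    none record { dual = λ () ; dual∙v = λ () ; projection-symmetric = λ _ _ → refl }
  dualBasis {suc k} v independent none = dualBasis (v ∘ suc) tail-independent λ D →
    let open DualBasisStep v independent D
    in u∙u≉0 (proj₁ (tight _ _) λ u∙u#0 → none (extend u∙u#0))
    where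
    tail-independent : LinearlyIndependent (v ∘ suc)
    tail-independent a a≈0 i = independent a⁺ (λ x → trans (+-congʳ (zeroˡ _)) (trans (+-identityˡ _) (a≈0 x))) (suc i)
      where
      a⁺ : Fin (suc k) → Carrier
      a⁺ zero    = 0#
      a⁺ (suc j) = a j

  -- A vanishing combination of the first `k` vectors extends by zero coefficients to a vanishing
  -- combination of all of them.
  prefix-independent : ∀ k {r N} {v : Fin (k ℕ.+ r) → Fin N → Carrier} →
    LinearlyIndependent v → LinearlyIndependent (λ (i : Fin k) → v (i ↑ˡ r))
  prefix-independent k {r} {N} {v} independent a a≈0 i =
    trans (reflexive (≡.sym (lookup-++ˡ a zeros i)))
      (independent (a ++ zeros) combination≈0 (i ↑ˡ r))
    where
    zeros : Fin r → Carrier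
    zeros _ = 0#
    combination≈0 : ∀ x → sum (λ j → (a ++ zeros) j * v j x) ≈ 0#
    combination≈0 x = begin
      sum (λ j → (a ++ zeros) j * v j x)
        ≈⟨ sum-↑ k (λ j → (a ++ zeros) j * v j x) ⟩
      sum (λ j → (a ++ zeros) (j ↑ˡ r) * v (j ↑ˡ r) x) + sum (λ j → (a ++ zeros) (k ↑ʳ j) * v (k ↑ʳ j) x)
        ≈⟨ +-cong (sum-cong-≋ λ j → *-congʳ (reflexive (lookup-++ˡ a zeros j)))
             (sum-zero λ j → trans (*-congʳ (reflexive (lookup-++ʳ a zeros j))) (zeroˡ _)) ⟩
      sum (λ j → a j * v (j ↑ˡ r) x) + 0#
        ≈⟨ trans (+-identityʳ _) (a≈0 x) ⟩
      0# ∎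
      where open ≈-Reasoning

  -- Traces of products with projections.

  ∑∑-distrib-+ : ∀ {m n} (f g : Fin m → Fin n → Carrier) →
    ∑[ i < m ] ∑[ j < n ] (f i j + g i j) ≈ ∑[ i < m ] ∑[ j < n ] f i j + ∑[ i < m ] ∑[ j < n ] g i j
  ∑∑-distrib-+ f g = trans (sum-cong-≋ λ i → ∑-distrib-+ (f i) (g i))
    (∑-distrib-+ (λ i → sum (f i)) (λ i → sum (g i)))

  *-∑∑ : ∀ {m n} s (f : Fin m → Fin n → Carrier) →
    s * ∑[ i < m ] ∑[ j < n ] f i j ≈ ∑[ i < m ] ∑[ j < n ] (s * f i j)
  *-∑∑ s f = trans (*-distribˡ-sum s (λ i → sum (f i))) (sum-cong-≋ λ i → *-distribˡ-sum s (f i))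

  -- Since P is symmetric and idempotent, tr (M P) is the sum over the rows of P of the quadratic
  -- form of M at that row. The bound on forms is applied to each row, and the rows are summed up
  -- again.
  projection-trace-≤ : ∀ {k N} {v : Fin k → Fin N → Carrier} (D : DualBasis v) →
    let open DualBasis D in (M : Matrix N) (a : Fin N → Carrier) →
    (∀ p → ∑[ x < N ] ∑[ z < N ] (M x z * (p z * p x)) ≤ ∑[ x < N ] (a x * (p x * p x))) →
    ∑[ x < N ] ∑[ z < N ] (M x z * projection z x) ≤ ∑[ x < N ] (a x * projection x x)
  projection-trace-≤ {N = N} D M a M≤a = begin
    ∑[ x < N ] ∑[ z < N ] (M x z * P z x)
      ≈⟨ sum-cong-≋ (λ x → sum-cong-≋ λ z → expand (M x z) z x) ⟩
    ∑[ x < N ] ∑[ z < N ] ∑[ y < N ] (M x z * (P y z * P y x))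
      ≈⟨ sum-cong-≋ (λ x → ∑-comm (λ z y → M x z * (P y z * P y x))) ⟩
    ∑[ x < N ] ∑[ y < N ] ∑[ z < N ] (M x z * (P y z * P y x))
      ≈⟨ ∑-comm (λ x y → ∑[ z < N ] (M x z * (P y z * P y x))) ⟩
    ∑[ y < N ] ∑[ x < N ] ∑[ z < N ] (M x z * (P y z * P y x))
      ≤⟨ sum-mono-≤ (λ y → M≤a (P y)) ⟩
    ∑[ y < N ] ∑[ x < N ] (a x * (P y x * P y x))
      ≈⟨ ∑-comm (λ y x → a x * (P y x * P y x)) ⟩
    ∑[ x < N ] ∑[ y < N ] (a x * (P y x * P y x))
      ≈⟨ sum-cong-≋ (λ x → expand (a x) x x) ⟨
    ∑[ x < N ] (a x * P x x) ∎
    where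
    open ≤-Reasoning
    open DualBasis D renaming (projection to P)
    expand : ∀ s z x → s * P z x ≈ ∑[ y < N ] (s * (P y z * P y x))
    expand s z x = trans
      (*-congˡ (trans (sym (projection-idempotent z x)) (sum-cong-≋ λ y → *-congʳ (projection-symmetric z y))))
      (*-distribˡ-sum s (λ y → P y z * P y x))

  -- The trace is `N` and no diagonal entry exceeds 1, so all of them equal 1. A row then has
  -- squared length 1 and inner product 1 with the unit vector, so its squared distance to that
  -- vector is 1 - 2 + 1 = 0.
  complete-projection : ∀ {N} {v : Fin N → Fin N → Carrier} (D : DualBasis v) →
    ∀ x z → DualBasis.projection D x z ≈ δ x z
  complete-projection {N} D x z = x∙y⁻¹≈ε⇒x≈y _ _ (square≈0⇒≈0
      (sum≈0⇒term≈0 (λ z → square-nonneg (P x z - δ x z)) distance≈0 z))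
    where
    open DualBasis D renaming (projection to P)

    diagonal≈1 : P x x ≈ 1#
    diagonal≈1 = sym (x∙y⁻¹≈ε⇒x≈y _ _
        (sum≈0⇒term≈0 (λ y → x≤y⇒0≤y-x (projection-diagonal-≤1 y)) ∑[1-P]≈0 x))
      where
      ∑[1-P]≈0 : ∑[ y < N ] (1# - P y y) ≈ 0#
      ∑[1-P]≈0 = +-identityʳ-unique (fromℕ N) _ (begin
        fromℕ N + ∑[ y < N ] (1# - P y y)
          ≈⟨ +-congʳ (sym projection-trace) ⟩
        ∑[ y < N ] P y y + ∑[ y < N ] (1# - P y y)
          ≈⟨ ∑-distrib-+ (λ y → P y y) (λ y → 1# - P y y) ⟨
        ∑[ y < N ] (P y y + (1# - P y y))
          ≈⟨ sum-cong-≋ (λ y → x+[y-x]≈y (P y y) 1#) ⟩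
        ∑[ y < N ] 1#
          ≈⟨ sum-const N 1# ⟩
        fromℕ N ∎)
        where open ≈-Reasoning

    e : Fin N → Carrier
    e z = P x z - δ x z

    -- The expansion of the squared difference, with the cross terms moved to the left so that the
    -- solver meets no subtraction.
    polarization : ∀ z → (δ x z * P x z + δ x z * P x z) + e z * e z ≈ P x z * P x z + δ x z * δ x z
    polarization z = begin
      (δ x z * P x z + δ x z * P x z) + e z * e z
        ≈⟨ +-congʳ (+-cong (*-congˡ P≈) (*-congˡ P≈)) ⟩
      (δ x z * (δ x z + e z) + δ x z * (δ x z + e z)) + e z * e z
        ≈⟨ solve 2 (λ d e → (d :* (d :+ e) :+ d :* (d :+ e)) :+ e :* e := (d :+ e) :* (d :+ e) :+ d :* d) refl (δ x z) (e z) ⟩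
      (δ x z + e z) * (δ x z + e z) + δ x z * δ x z
        ≈⟨ +-congʳ (*-cong P≈ P≈) ⟨
      P x z * P x z + δ x z * δ x z ∎
      where
      open ≈-Reasoning
      P≈ : P x z ≈ δ x z + e z
      P≈ = sym (x+[y-x]≈y (δ x z) (P x z))

    distance≈0 : e ∙ e ≈ 0#
    distance≈0 = +-identityʳ-unique (1# + 1#) _ (begin
      (1# + 1#) + e ∙ e
        ≈⟨ +-congʳ (+-cong δ∙P≈1 δ∙P≈1) ⟨
      (δ x ∙ P x + δ x ∙ P x) + e ∙ e
        ≈⟨ +-congʳ (sym (∑-distrib-+ (λ z → δ x z * P x z) (λ z → δ x z * P x z))) ⟩
      ∑[ z < N ] (δ x z * P x z + δ x z * P x z) + e ∙ e
        ≈⟨ sym (∑-distrib-+ (λ z → δ x z * P x z + δ x z * P x z) (λ z → e z * e z)) ⟩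
      ∑[ z < N ] ((δ x z * P x z + δ x z * P x z) + e z * e z)
        ≈⟨ sum-cong-≋ polarization ⟩
      ∑[ z < N ] (P x z * P x z + δ x z * δ x z)
        ≈⟨ ∑-distrib-+ (λ z → P x z * P x z) (λ z → δ x z * δ x z) ⟩
      P x ∙ P x + δ x ∙ δ x
        ≈⟨ +-cong (trans (projection-diagonal x) diagonal≈1) (trans (sum-δ x (δ x)) (reflexive (δ-refl x))) ⟩
      1# + 1# ∎)
      where
      open ≈-Reasoning
      δ∙P≈1 : δ x ∙ P x ≈ 1#
      δ∙P≈1 = trans (sum-δ x (P x)) diagonal≈1

  -- Writing `N` as `k + r` lets `↑ˡ` pick the first `k` eigenvectors. The double negation is
  -- inherited from `dualBasis`.
  prefix-projection : ∀ {N} {M : Matrix N} (σ : Spectrum M) k → k ℕ.≤ N →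
    ¬ ¬ ∃ λ (v : Fin k → Fin N → Carrier) → ∃ λ (D : DualBasis v) →
      ∑[ x < N ] ∑[ z < N ] (M x z * DualBasis.projection D z x) ≈ S k σ
  prefix-projection {M = M} σ k k≤N none with ℕ.m≤n⇒∃[o]m+o≡n k≤N
  ... | r , ≡.refl = dualBasis v (prefix-independent k independent) λ D →
    none (v , D , trans
      (DualBasis.eigenvalue-trace D M (λ i → eigenvalue (i ↑ˡ r)) (λ i → isEigenvector (i ↑ˡ r)))
      (sym (sumFirst-↑ k eigenvalue)))
    where
    open Spectrum σ
    v : Fin k → Fin (k ℕ.+ r) → Carrier
    v i = eigenvector (i ↑ˡ r)

  -- Degrees, adjacency and quadratic forms of a graph.

  fromℕ-count : ∀ {a p n} {A : Set a} {P : A → Set p} (P? : ∀ x → Dec (P x)) (f : Fin n → A) →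
    fromℕ (Vec.count P? (Vec.tabulate f)) ≈ ∑[ i < n ] (if does (P? (f i)) then 1# else 0#)
  fromℕ-count {n = zero}  P? f = refl
  fromℕ-count {n = suc n} P? f with does (P? (f zero))
  ... | true  = +-congˡ (fromℕ-count P? (f ∘ suc))
  ... | false = trans (fromℕ-count P? (f ∘ suc)) (sym (+-identityˡ _))

  module _ {n} (G : Graph n) where
    open Graph G

    row-sum : ∀ u → ∑[ v < n ] adjacency G u v ≈ fromℕ (degree u)
    row-sum u = sym (fromℕ-count (u ~?_) id)

    adjacency-sym : ∀ u v → adjacency G u v ≡ adjacency G v u
    adjacency-sym u v with u ~? v | v ~? u
    ... | yes _   | yes _   = ≡.refl
    ... | no _    | no _    = ≡.refl
    ... | yes u~v | no v≁u  = contradiction (~-sym u~v) v≁u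
    ... | no u≁v  | yes v~u = contradiction (~-sym v~u) u≁v

    adjacency-irrefl : ∀ u → adjacency G u u ≡ 0#
    adjacency-irrefl u with u ~? u
    ... | yes u~u = contradiction u~u (~-irrefl ≡.refl)
    ... | no _    = ≡.refl

    adjacency-nonneg : ∀ u v → 0# ≤ adjacency G u v
    adjacency-nonneg u v with does (u ~? v)
    ... | true  = 0≤1
    ... | false = ≤-refl

    degree-form : (Fin n → Carrier) → Carrier
    degree-form p = ∑[ u < n ] (fromℕ (degree u) * (p u * p u))

    degree-form-rows : ∀ p → degree-form p ≈ ∑[ u < n ] ∑[ v < n ] (adjacency G u v * (p u * p u))
    degree-form-rows p = sum-cong-≋ λ u →
      trans (*-congʳ (sym (row-sum u))) (*-distribʳ-sum (p u * p u) (adjacency G u))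

    -- Together with the row version this gives each ordered adjacent pair both `p u * p u` and
    -- `p v * p v`, the terms that dominate twice the mixed product.
    degree-form-columns : ∀ p → degree-form p ≈ ∑[ u < n ] ∑[ v < n ] (adjacency G u v * (p v * p v))
    degree-form-columns p = trans (degree-form-rows p) (trans
      (∑-comm (λ u v → adjacency G u v * (p u * p u)))
      (sum-cong-≋ λ v → sum-cong-≋ λ u → *-congʳ (reflexive (adjacency-sym u v))))

    -- The Laplacian is positive semidefinite.
    adjacency-form-≤ : ∀ p → ∑[ u < n ] ∑[ v < n ] (adjacency G u v * (p v * p u)) ≤ degree-form p
    adjacency-form-≤ p = x+x≤y+y⇒x≤y (begin
      X + X
        ≈⟨ ∑∑-distrib-+ (λ u v → a u v * (p v * p u)) (λ u v → a u v * (p v * p u)) ⟨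
      ∑[ u < n ] ∑[ v < n ] (a u v * (p v * p u) + a u v * (p v * p u))
        ≤⟨ sum-mono-≤ (λ u → sum-mono-≤ λ v → pointwise u v) ⟩
      ∑[ u < n ] ∑[ v < n ] (a u v * (p u * p u) + a u v * (p v * p v))
        ≈⟨ ∑∑-distrib-+ (λ u v → a u v * (p u * p u)) (λ u v → a u v * (p v * p v)) ⟩
      ∑[ u < n ] ∑[ v < n ] (a u v * (p u * p u)) + ∑[ u < n ] ∑[ v < n ] (a u v * (p v * p v))
        ≈⟨ +-cong (degree-form-rows p) (degree-form-columns p) ⟨
      degree-form p + degree-form p ∎)
      where
      open ≤-Reasoning
      a = adjacency G
      X = ∑[ u < n ] ∑[ v < n ] (a u v * (p v * p u))
      pointwise : ∀ u v → a u v * (p v * p u) + a u v * (p v * p u) ≤ a u v * (p u * p u) + a u v * (p v * p v)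
      pointwise u v = begin
        a u v * (p v * p u) + a u v * (p v * p u)
          ≈⟨ distribˡ (a u v) _ _ ⟨
        a u v * (p v * p u + p v * p u)
          ≤⟨ *-monoˡ-≤ (adjacency-nonneg u v) (2xy≤x²+y² (p u) (p v)) ⟩
        a u v * (p u * p u + p v * p v)
          ≈⟨ distribˡ (a u v) _ _ ⟩
        a u v * (p u * p u) + a u v * (p v * p v) ∎

    -- The form splits into the degree form with weight `α` and the adjacency form with weight
    -- `1# - α`. The latter is at most the degree form, and the weights add up to 1.
    A[]-form-≤ : ∀ α → 0# ≤ 1# - α → ∀ p →
      ∑[ u < n ] ∑[ v < n ] (A[ α ] G u v * (p v * p u)) ≤ degree-form p
    A[]-form-≤ α 0≤1-α p = begin
      ∑[ u < n ] ∑[ v < n ] (A[ α ] G u v * (p v * p u))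
        ≈⟨ sum-cong-≋ (λ u → sum-cong-≋ λ v → solve 5 (λ s t d a q → (s :* d :+ t :* a) :* q := s :* (d :* q) :+ t :* (a :* q)) refl
             α (1# - α) (degreeMatrix G u v) (adjacency G u v) (p v * p u)) ⟩
      ∑[ u < n ] ∑[ v < n ] (α * (degreeMatrix G u v * (p v * p u)) + (1# - α) * (adjacency G u v * (p v * p u)))
        ≈⟨ ∑∑-distrib-+ (λ u v → α * (degreeMatrix G u v * (p v * p u))) (λ u v → (1# - α) * (adjacency G u v * (p v * p u))) ⟩
      ∑[ u < n ] ∑[ v < n ] (α * (degreeMatrix G u v * (p v * p u))) + ∑[ u < n ] ∑[ v < n ] ((1# - α) * (adjacency G u v * (p v * p u)))
        ≈⟨ +-cong (*-∑∑ α (λ u v → degreeMatrix G u v * (p v * p u))) (*-∑∑ (1# - α) (λ u v → adjacency G u v * (p v * p u))) ⟨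
      α * ∑[ u < n ] ∑[ v < n ] (degreeMatrix G u v * (p v * p u)) + (1# - α) * ∑[ u < n ] ∑[ v < n ] (adjacency G u v * (p v * p u))
        ≈⟨ +-congʳ (*-congˡ (sum-cong-≋ λ u → sum-diagonal u (fromℕ (degree u)) (λ v → p v * p u))) ⟩
      α * degree-form p + (1# - α) * ∑[ u < n ] ∑[ v < n ] (adjacency G u v * (p v * p u))
        ≤⟨ +-mono-≤ ≤-refl (*-monoˡ-≤ 0≤1-α (adjacency-form-≤ p)) ⟩
      α * degree-form p + (1# - α) * degree-form p
        ≈⟨ distribʳ (degree-form p) α (1# - α) ⟨
      (α + (1# - α)) * degree-form p
        ≈⟨ trans (*-congʳ (x+[y-x]≈y α 1#)) (*-identityˡ _) ⟩
      degree-form p ∎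
      where open ≤-Reasoning

    -- The weights are the diagonal entries of the projection onto the span of the first `k`
    -- eigenvectors.
    S-A[]-≤ : ∀ α → 0# ≤ 1# - α → (σ : Spectrum (A[ α ] G)) → ∀ k → k ℕ.≤ n →
      ¬ ¬ ∃ λ (w : Fin n → Carrier) → (∀ u → 0# ≤ w u) × (∀ u → w u ≤ 1#) × sum w ≈ fromℕ k ×
        S k σ ≤ ∑[ u < n ] (fromℕ (degree u) * w u)
    S-A[]-≤ α 0≤1-α σ k k≤n none = prefix-projection σ k k≤n λ (v , D , trace≈S) →
      let open DualBasis D in
      none ( (λ u → projection u u) , projection-diagonal-nonneg , projection-diagonal-≤1 , projection-trace
           , ≤-trans (≤-reflexive (sym trace≈S))
               (projection-trace-≤ D (A[ α ] G) (λ u → fromℕ (degree u)) (A[]-form-≤ α 0≤1-α)))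

    -- The projection onto the span of all eigenvectors is the identity, so the sum is the trace of
    -- the adjacency matrix, which is 0 for lack of loops. Tightness allows arguing from apartness
    -- to a contradiction, which absorbs the double negation.
    eigenvalue-sum : (τ : Spectrum (adjacency G)) → sum (Spectrum.eigenvalue τ) ≈ 0#
    eigenvalue-sum τ = proj₁ (tight _ _) λ ∑#0 → dualBasis eigenvector independent λ D → #-irrefl (begin
      sum eigenvalue
        ≈⟨ DualBasis.eigenvalue-trace D (adjacency G) eigenvalue isEigenvector ⟨
      ∑[ u < n ] ∑[ v < n ] (adjacency G u v * DualBasis.projection D v u)
        ≈⟨ sum-cong-≋ (λ u → sum-cong-≋ λ v → trans (*-congˡ (trans (DualBasis.projection-symmetric D v u) (complete-projection D u v))) (*-comm _ _)) ⟩
      ∑[ u < n ] ∑[ v < n ] (δ u v * adjacency G u v)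
        ≈⟨ sum-cong-≋ (λ u → sum-δ u (adjacency G u)) ⟩
      ∑[ u < n ] adjacency G u u
        ≈⟨ sum-zero (λ u → reflexive (adjacency-irrefl u)) ⟩
      0# ∎) ∑#0
      where
      open ≈-Reasoning
      open Spectrum τ

    -- The mean of the `k` largest eigenvalues is at least the mean of all, which is 0. In
    -- `weighted-sum-≤` this is the case of constant weights `k` with cap `n`: both threshold terms
    -- are then `θ` times `n k` and cancel.
    S-adjacency-nonneg : (τ : Spectrum (adjacency G)) → ∀ k → k ℕ.< n → 0# ≤ S k τ
    S-adjacency-nonneg τ k k<n = *-cancelˡ-nonneg (0<fromℕ k<n) (+-cancelʳ-≤ (θ * (k · fromℕ n)) (begin
      0# + θ * (k · fromℕ n)
        ≈⟨ +-congʳ (sym (trans (sym (*-distribʳ-sum (fromℕ k) eigenvalue)) (trans (*-congʳ (eigenvalue-sum τ)) (zeroˡ _)))) ⟩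
      ∑[ i < n ] (eigenvalue i * fromℕ k) + θ * (k · fromℕ n)
        ≤⟨ weighted-sum-≤ k eigenvalue (λ _ → fromℕ k) (fromℕ n) θ (ℕ.<⇒≤ k<n)
             (λ i i<k → nonincreasing (≡.subst (toℕ i ℕ.≤_) (≡.sym j≡k) (ℕ.<⇒≤ i<k)))
             (λ i k≤i → nonincreasing (≡.subst (ℕ._≤ toℕ i) (≡.sym j≡k) k≤i))
             (λ _ → fromℕ-nonneg k) (λ _ → fromℕ-mono (ℕ.<⇒≤ k<n)) ⟩
      fromℕ n * S k τ + θ * ∑[ i < n ] fromℕ k
        ≈⟨ +-congˡ (*-congˡ (trans (sum-const n (fromℕ k)) n·k≈k·n)) ⟩
      fromℕ n * S k τ + θ * (k · fromℕ n) ∎))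
      where
      open ≤-Reasoning
      open Spectrum τ
      -- Counting from zero, index `k` is the first one after the `k` largest, so its eigenvalue
      -- separates them from the rest.
      j = fromℕ< k<n
      j≡k : toℕ j ≡ k
      j≡k = toℕ-fromℕ< k<n
      θ = eigenvalue j
      n·k≈k·n : n · fromℕ k ≈ k · fromℕ n
      n·k≈k·n = trans (×-assocˡ 1# n k) (trans (reflexive (≡.cong fromℕ (ℕ.*-comm n k))) (sym (×-assocˡ 1# k n)))

  -- Sums and degrees over the double graph.

  remainder-combine : ∀ {m n} (i : Fin m) (j : Fin n) → remainder {m} n (combine i j) ≡ j
  remainder-combine i j = ≡.cong proj₂ (remQuot-combine i j)

  sum-2* : ∀ n (f : Fin (2 ℕ.* n) → Carrier) →
    sum f ≈ ∑[ u < n ] (f (combine {2} zero u) + f (combine {2} (suc zero) u))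
  sum-2* n f = begin
    sum f
      ≈⟨ sum-↑ n f ⟩
    ∑[ u < n ] f (u ↑ˡ (n ℕ.+ 0)) + ∑[ u < n ℕ.+ 0 ] f (n ↑ʳ u)
      -- `2 * n` unfolds to `n + (n + 0)`, so a second split leaves an empty block.
      ≈⟨ +-congˡ (trans (sum-↑ n (λ u → f (n ↑ʳ u))) (+-identityʳ _)) ⟩
    ∑[ u < n ] f (u ↑ˡ (n ℕ.+ 0)) + ∑[ u < n ] f (n ↑ʳ (u ↑ˡ 0))
      ≈⟨ ∑-distrib-+ (λ u → f (u ↑ˡ (n ℕ.+ 0))) (λ u → f (n ↑ʳ (u ↑ˡ 0))) ⟨
    ∑[ u < n ] (f (u ↑ˡ (n ℕ.+ 0)) + f (n ↑ʳ (u ↑ˡ 0))) ∎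
    where open ≈-Reasoning

  module _ {n} (G : Graph n) where

    -- A row of the adjacency matrix of the double graph is the row of `G` written twice.
    degree-double : ∀ (i : Fin 2) u →
      fromℕ (Graph.degree (double G) (combine i u)) ≈ fromℕ 2 * fromℕ (Graph.degree G u)
    degree-double i u = begin
      fromℕ (Graph.degree (double G) (combine i u))
        ≈⟨ row-sum (double G) (combine i u) ⟨
      ∑[ y < 2 ℕ.* n ] adjacency G (remainder {2} n (combine i u)) (remainder {2} n y)
        ≈⟨ sum-2* n (λ y → adjacency G (remainder {2} n (combine i u)) (remainder {2} n y)) ⟩
      ∑[ v < n ] (adjacency G (remainder {2} n (combine i u)) (remainder {2} n (combine {2} zero v)) +
                  adjacency G (remainder {2} n (combine i u)) (remainder {2} n (combine {2} (suc zero) v)))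
        ≈⟨ sum-cong-≋ (λ v → +-cong (entry zero v) (entry (suc zero) v)) ⟩
      ∑[ v < n ] (adjacency G u v + adjacency G u v)
        ≈⟨ ∑-distrib-+ (adjacency G u) (adjacency G u) ⟩
      ∑[ v < n ] adjacency G u v + ∑[ v < n ] adjacency G u v
        ≈⟨ +-cong (row-sum G u) (row-sum G u) ⟩
      fromℕ d + fromℕ d
        ≈⟨ solve 1 (λ d → d :+ d := (con 1 :+ (con 1 :+ con 0)) :* d) refl (fromℕ d) ⟩
      fromℕ 2 * fromℕ d ∎
      where
      open ≈-Reasoning
      d = Graph.degree G u
      entry : ∀ (j : Fin 2) v →
        adjacency G (remainder {2} n (combine i u)) (remainder {2} n (combine j v)) ≈ adjacency G u v
      entry j v = reflexive (≡.cong₂ (adjacency G) (remainder-combine i u) (remainder-combine j v))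

    -- w lives on the vertices of the double graph; t adds it up over the two copies of
    -- each vertex, in the order of the degree sequence.
    S-double-≤ : ∀ {d} → IsDegreeSequence G d → ∀ {α} → α ≤ 1# → (σ : Spectrum (A[ α ] (double G))) →
      ∀ {k} → k ℕ.≤ 2 ℕ.* n →
      ¬ ¬ ∃ λ (t : Fin n → Carrier) → (∀ i → 0# ≤ t i) × (∀ i → t i ≤ fromℕ 2) × sum t ≈ fromℕ k ×
        S k σ ≤ fromℕ 2 * ∑[ i < n ] (fromℕ (d i) * t i)
    S-double-≤ {d} degrees {α} α≤1 σ {k} k≤2n none =
      S-A[]-≤ (double G) α (x≤y⇒0≤y-x α≤1) σ k k≤2n λ (w , 0≤w , w≤1 , ∑w≈k , S≤) →
      let
        s : Fin n → Carrier
        s u = w (combine {2} zero u) + w (combine {2} (suc zero) u)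
      in none
        ( (λ i → s (π ⟨$⟩ʳ i))
        , (λ i → ≤-trans (0≤w _) (x≤x+y _ (0≤w _)))
        , (λ i → ≤-trans (+-mono-≤ (w≤1 _) (w≤1 _)) (≤-reflexive (+-congˡ (sym (+-identityʳ 1#)))))
        , trans (sym (sum-permute s π)) (trans (sym (sum-2* n w)) ∑w≈k)
        , (begin
            S k σ
              ≤⟨ S≤ ⟩
            ∑[ x < 2 ℕ.* n ] (deg² x * w x)
              ≈⟨ sum-2* n (λ x → deg² x * w x) ⟩
            ∑[ u < n ] (deg² (combine {2} zero u) * w (combine {2} zero u) +
                        deg² (combine {2} (suc zero) u) * w (combine {2} (suc zero) u))
              ≈⟨ sum-cong-≋ (λ u → +-cong (*-congʳ (degree-double zero u)) (*-congʳ (degree-double (suc zero) u))) ⟩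
            ∑[ u < n ] (fromℕ 2 * deg u * w (combine {2} zero u) + fromℕ 2 * deg u * w (combine {2} (suc zero) u))
              ≈⟨ sum-cong-≋ (λ u → solve 4 (λ e a x y → e :* a :* x :+ e :* a :* y := e :* (a :* (x :+ y))) refl
                   (fromℕ 2) (deg u) (w (combine {2} zero u)) (w (combine {2} (suc zero) u))) ⟩
            ∑[ u < n ] (fromℕ 2 * (deg u * s u))
              ≈⟨ sum-permute (λ u → fromℕ 2 * (deg u * s u)) π ⟩
            ∑[ i < n ] (fromℕ 2 * (deg (π ⟨$⟩ʳ i) * s (π ⟨$⟩ʳ i)))
              ≈⟨ sum-cong-≋ (λ i → *-congˡ (*-congʳ (reflexive (≡.cong fromℕ (≡.sym (proj₂ rearrangement i)))))) ⟩
            ∑[ i < n ] (fromℕ 2 * (fromℕ (d i) * s (π ⟨$⟩ʳ i)))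
              ≈⟨ *-distribˡ-sum (fromℕ 2) (λ i → fromℕ (d i) * s (π ⟨$⟩ʳ i)) ⟨
            fromℕ 2 * ∑[ i < n ] (fromℕ (d i) * s (π ⟨$⟩ʳ i)) ∎))
      where
      open ≤-Reasoning
      open IsDegreeSequence degrees using (rearrangement)
      π = proj₁ rearrangement
      deg² : Fin (2 ℕ.* n) → Carrier
      deg² x = fromℕ (Graph.degree (double G) x)
      deg : Fin n → Carrier
      deg u = fromℕ (Graph.degree G u)

    -- Bounds in terms of the degree sequence.

    module _ {d : Fin n → ℕ} (degrees : IsDegreeSequence G d) {α : Carrier} (α≤1 : α ≤ 1#)
             (σ : Spectrum (A[ α ] (double G))) where
      open IsDegreeSequence degrees using (nonincreasing)

      f : Fin n → Carrier
      f i = fromℕ (d i)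

      -- The `m` largest degrees take the full weight 2, one for each copy, and the remaining weight
      -- `e` is charged at the threshold `θ`. The outer factor 2 comes from the doubling of degrees.
      S-≤-threshold : ∀ {k} → k ℕ.≤ 2 ℕ.* n → ∀ m θ e → m ℕ.≤ n →
        (∀ i → toℕ i ℕ.< m → θ ≤ f i) → (∀ i → m ℕ.≤ toℕ i → f i ≤ θ) →
        fromℕ k ≈ e + m · fromℕ 2 →
        S k σ ≤ fromℕ 2 * (fromℕ 2 * sumFirst m f + θ * e)
      -- The conclusion is a negation: supposing its failure `S>` is what allows the weights to be
      -- taken out of the double negation.
      S-≤-threshold {k} k≤2n m θ e m≤n θ≤f f≤θ k≈ S> =
        S-double-≤ degrees α≤1 σ k≤2n λ (t , 0≤t , t≤2 , ∑t≈k , S≤) →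
        ≤-trans S≤ (*-monoˡ-≤ (fromℕ-nonneg 2) (+-cancelʳ-≤ (θ * (m · fromℕ 2)) (begin
          ∑[ i < n ] (f i * t i) + θ * (m · fromℕ 2)
            ≤⟨ weighted-sum-≤ m f t (fromℕ 2) θ m≤n θ≤f f≤θ 0≤t t≤2 ⟩
          fromℕ 2 * sumFirst m f + θ * sum t
            ≈⟨ +-congˡ (trans (*-congˡ (trans ∑t≈k k≈)) (distribˡ θ e _)) ⟩
          fromℕ 2 * sumFirst m f + (θ * e + θ * (m · fromℕ 2))
            ≈⟨ +-assoc _ _ _ ⟨
          fromℕ 2 * sumFirst m f + θ * e + θ * (m · fromℕ 2) ∎))) S>
        where open ≤-Reasoning

      S-≤-threshold-at : ∀ {k} → k ℕ.≤ 2 ℕ.* n → ∀ (j : Fin n) {m} → toℕ j ≡ m → ∀ e →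
        fromℕ k ≈ e + m · fromℕ 2 →
        S k σ ≤ fromℕ 2 * (fromℕ 2 * sumFirst m f + f j * e)
      S-≤-threshold-at k≤2n j ≡.refl e = S-≤-threshold k≤2n (toℕ j) (f j) e (ℕ.<⇒≤ (toℕ<n j))
        (λ i i<j → fromℕ-mono (nonincreasing (ℕ.<⇒≤ i<j)))
        (λ i j≤i → fromℕ-mono (nonincreasing j≤i))

      fromℕ-2* : ∀ m → fromℕ (2 ℕ.* m) ≈ m · fromℕ 2
      fromℕ-2* m = trans (reflexive (≡.cong fromℕ (ℕ.*-comm 2 m))) (sym (×-assocˡ 1# m 2))

      S-even-≤ : ∀ m → 2 ℕ.* m ℕ.≤ 2 ℕ.* n → S (2 ℕ.* m) σ ≤ 4 · sumFirst m f
      S-even-≤ m 2m≤2n = ≤-trans bound (≤-reflexive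
          (solve 1 (λ F → two :* (two :* F :+ con 0) := F :+ (F :+ (F :+ (F :+ con 0)))) refl (sumFirst m f)))
        where
        two : ∀ {n} → Polynomial n
        two = con 1 :+ (con 1 :+ con 0)
        m≤n = ℕ.*-cancelˡ-≤ 2 2m≤2n
        2m≈ : fromℕ (2 ℕ.* m) ≈ 0# + m · fromℕ 2
        2m≈ = trans (fromℕ-2* m) (sym (+-identityˡ _))
        bound : S (2 ℕ.* m) σ ≤ fromℕ 2 * (fromℕ 2 * sumFirst m f + 0#)
        bound with ℕ.m≤n⇒m<n∨m≡n m≤n
        ... | inj₁ m<n = ≤-trans (S-≤-threshold-at 2m≤2n (fromℕ< m<n) (toℕ-fromℕ< m<n) 0# 2m≈)
                (≤-reflexive (*-congˡ (+-congˡ (zeroʳ _))))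
        -- When `m` equals `n` no further degree can serve as threshold; 0 lies below all degrees,
        -- and the condition on later indices is vacuous.
        ... | inj₂ m≡n = ≤-trans
                (S-≤-threshold 2m≤2n m 0# 0# m≤n (λ i _ → fromℕ-nonneg (d i))
                  (λ i m≤i → contradiction (toℕ<n i) (ℕ.≤⇒≯ (≡.subst (ℕ._≤ toℕ i) m≡n m≤i))) 2m≈)
                (≤-reflexive (*-congˡ (+-congˡ (zeroʳ _))))

      -- After weight 2 on each of the `toℕ j` largest degrees, weight 1 is left for the next one,
      -- `d j`, which is also the threshold.
      S-odd-≤ : ∀ j → suc (2 ℕ.* toℕ j) ℕ.≤ 2 ℕ.* n →
        S (suc (2 ℕ.* toℕ j)) σ ≤ 4 · sumFirst (toℕ j) f + 2 · f j
      S-odd-≤ j k≤2n = ≤-trans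
        (S-≤-threshold-at k≤2n j ≡.refl 1# (+-congˡ (fromℕ-2* (toℕ j))))
        (≤-reflexive (solve 2 (λ F θ → two :* (two :* F :+ θ :* con 1) :=
            F :+ (F :+ (F :+ (F :+ con 0))) :+ (θ :+ (θ :+ con 0))) refl (sumFirst (toℕ j) f) (f j)))
        where
        two : ∀ {n} → Polynomial n
        two = con 1 :+ (con 1 :+ con 0)

theorem6p4 :
    ∀ {c ℓ₁ ℓ₂} (ℝ : RealNumbers c ℓ₁ ℓ₂) →
    let open RealNumbers ℝ
        open Spectra ℝ
    in
    ∀ {n : ℕ} (G : Graph n) (d : Fin n → ℕ) → IsDegreeSequence G d →
    ∀ (α : Carrier) → 0# ≤ α → α ≤ 1# →
    ∀ (σ : Spectrum (A[ α ] (double G))) (k : ℕ) →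
      (∀ (m : ℕ) → k ≡ 2 ℕ.* m → 1 ℕ.< k → k ℕ.< n →
        ∀ (τ : Spectrum (adjacency G)) →
        S k σ ≤ 4 · sumFirst m (fromℕ ∘ d) + 2 · ((1# - α) * S k τ))
      ×
      -- The zero-based index j = (k - 1) / 2 denotes the term d_{(k+1)/2}.
      (∀ (j : Fin n) → k ≡ suc (2 ℕ.* toℕ j) → 1 ℕ.≤ k → k ℕ.< n →
        ∀ (τ : Spectrum (adjacency G)) →
        S k σ ≤ 4 · sumFirst (toℕ j) (fromℕ ∘ d) + 2 · fromℕ (d j) + 2 · ((1# - α) * S k τ))
      ×
      (∀ (m : ℕ) → k ≡ 2 ℕ.* m → n ℕ.≤ k → k ℕ.≤ 2 ℕ.* n →
        S k σ ≤ 4 · sumFirst m (fromℕ ∘ d))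
      ×
      (∀ (j : Fin n) → k ≡ suc (2 ℕ.* toℕ j) → n ℕ.≤ k → k ℕ.≤ 2 ℕ.* n →
        S k σ ≤ 4 · sumFirst (toℕ j) (fromℕ ∘ d) + 2 · fromℕ (d j))
theorem6p4 ℝ {n} G d degrees α _ α≤1 σ k =
    (λ { m ≡.refl _ k<n τ → weaken k<n τ (S-even-≤ G degrees α≤1 σ m (<n⇒≤2n k<n)) })
  , (λ { j ≡.refl _ k<n τ → weaken k<n τ (S-odd-≤ G degrees α≤1 σ j (<n⇒≤2n k<n)) })
  , (λ { m ≡.refl _ k≤2n → S-even-≤ G degrees α≤1 σ m k≤2n })
  , (λ { j ≡.refl _ k≤2n → S-odd-≤ G degrees α≤1 σ j k≤2n })
  where
  open RealNumbers ℝ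
  open Spectra ℝ
  open OrderedField ℝ
  <n⇒≤2n : ∀ {k} → k ℕ.< n → k ℕ.≤ 2 ℕ.* n
  <n⇒≤2n k<n = ℕ.≤-trans (ℕ.<⇒≤ k<n) (ℕ.m≤m+n n (n ℕ.+ 0))
  -- Both bounds for `k < n` follow from those valid up to `2 n` by adding a nonnegative term.
  weaken : ∀ {k s x} → k ℕ.< n → (τ : Spectrum (adjacency G)) → s ≤ x → s ≤ x + 2 · ((1# - α) * S k τ)
  weaken {k} k<n τ s≤x = ≤-trans s≤x
    (x≤x+y _ (·-nonneg 2 (*-nonneg (x≤y⇒0≤y-x α≤1) (S-adjacency-nonneg G τ k k<n))))
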